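{- Let $G$ be a connected graph of order $n$ and let $\Gamma$ be a family of graphs such that $V(F)=V$ for every $F\in\Gamma$. Consider any function $h:V(G)\to\Gamma$. Then $$\kappa(G\circ_h\Gamma)=\begin{cases}(n-1)|V|+\min_{v\in V(G)}\kappa(h(v)), & \text{if } G=K_n,\ n\ge 1,\\ \kappa(G)\,|V|, & \text{if } G\neq K_n.\end{cases}$$
   Context: All graphs are finite and simple. For a graph $G$, a family of graphs $\Gamma$ and a function $h:V(G)\to\Gamma$, the product $G\circ_h\Gamma$ is the graph with vertex set $\bigcup_{a\in V(G)}\{(a,x): x\in V(h(a))\}$ in which $(a,x)(b,y)$ is an edge if and only if either $ab\in E(G)$, or $a=b$ and $xy\in E(h(a))$. The connectivity $\kappa(G)$ is the minimum size of a set of vertices whose deletion disconnects $G$ (so $\kappa=0$ for a disconnected graph), with the usual convention $\kappa(K_m)=m-1$ for complete graphs. -}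

module Defs where

open import Data.Fin using (Fin; remQuot)
open import Data.Fin.Properties using (any?; _≟_)
open import Data.Fin.Subset using (Subset; _∈_; _∉_; ∣_∣; ∁; ⁅_⁆; _∪_)
open import Data.Fin.Subset.Properties
  using (_∈?_; anySubset?; x∈⁅x⁆; x∈⁅y⁆⇒x≡y; x∈p∪q⁻; x∈p∪q⁺; x∈p⇒x∉∁p; x∉∁p⇒x∈p)
open import Data.List using (List; []; _∷_; allFin)
open import Data.List.Membership.Propositional using () renaming (_∈_ to _∈ₗ_)
open import Data.List.Membership.Propositional.Properties using (∈-allFin)
open import Data.List.Relation.Unary.Any using (here; there)
open import Data.Nat using (ℕ; suc; NonZero; _*_; _∸_; _≤_; _<_; _<?_; _⊓_)
open import Data.Nat.Induction using (<-rec)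
open import Data.Nat.Properties using (≮⇒≥)
open import Data.Product using (∃; ∃₂; _×_; _,_; proj₁; proj₂)
open import Data.Sum using (_⊎_; inj₁; inj₂)
open import Data.Vec using (tabulate; foldr₁)
open import Level using (Level; 0ℓ)
open import Relation.Binary.Core using (Rel)
open import Relation.Binary.Definitions using (Symmetric; Irreflexive; Decidable)
open import Relation.Binary.Construct.Closure.ReflexiveTransitive using (Star; ε; _◅_; _◅◅_)
open import Relation.Binary.PropositionalEquality using (_≡_; _≢_; refl; sym)
open import Relation.Nullary using (¬_; Dec; yes; no; ¬?; _×-dec_; _⊎-dec_)
open import Relation.Nullary.Decidable using (map′; decidable-stable)

record Graph (n : ℕ) : Set₁ where
  field
    Adj        : Rel (Fin n) 0ℓ
    adj?       : Decidable Adj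
    adj-sym    : Symmetric Adj
    adj-irrefl : Irreflexive _≡_ Adj

open Graph public

Complete : ∀ {n} → Graph n → Set
Complete G = ∀ u v → u ≢ v → Adj G u v

Connected : ∀ {n} → Graph n → Set
Connected G = ∀ u v → Star (Adj G) u v

-- The edges of G - S.
AdjOutside : ∀ {n} → Graph n → Subset n → Rel (Fin n) 0ℓ
AdjOutside G S u v = u ∉ S × v ∉ S × Adj G u v

Disconnects : ∀ {n} → Graph n → Subset n → Set
Disconnects G S = ∃₂ λ u v → u ∉ S × v ∉ S × ¬ Star (AdjOutside G S) u v

-- No set of vertices disconnects a complete graph, so κ(K_n) = n - 1 is a
-- convention.  With truncated subtraction the graph on no vertices gets 0.
data IsConnectivity {n} (G : Graph n) : ℕ → Set where
  complete   : Complete G → IsConnectivity G (n ∸ 1)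
  incomplete : ∀ {k} → ¬ Complete G →
               (∃ λ S → Disconnects G S × ∣ S ∣ ≡ k) →
               (∀ S → Disconnects G S → k ≤ ∣ S ∣) →
               IsConnectivity G k

-- Reachability is decidable: Via R xs u v says that some R-walk from u to v
-- has all its intermediate vertices in xs.
private
  Via : ∀ {n} → Rel (Fin n) 0ℓ → List (Fin n) → Rel (Fin n) 0ℓ
  Via R []       u v = u ≡ v ⊎ R u v
  Via R (x ∷ xs) u v = Via R xs u v ⊎ (Via R xs u x × Via R xs x v)

  via? : ∀ {n} {R : Rel (Fin n) 0ℓ} → Decidable R → ∀ xs → Decidable (Via R xs)
  via? R? []       u v = u ≟ v ⊎-dec R? u v
  via? R? (x ∷ xs) u v = via? R? xs u v ⊎-dec (via? R? xs u x ×-dec via? R? xs x v)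

  via⇒star : ∀ {n} {R : Rel (Fin n) 0ℓ} xs {u v} → Via R xs u v → Star R u v
  via⇒star []       (inj₁ refl)    = ε
  via⇒star []       (inj₂ r)       = r ◅ ε
  via⇒star (x ∷ xs) (inj₁ p)       = via⇒star xs p
  via⇒star (x ∷ xs) (inj₂ (p , q)) = via⇒star xs p ◅◅ via⇒star xs q

  base⇒via : ∀ {n} {R : Rel (Fin n) 0ℓ} xs {u v} → u ≡ v ⊎ R u v → Via R xs u v
  base⇒via []       r = r
  base⇒via (x ∷ xs) r = inj₁ (base⇒via xs r)

  via-trans : ∀ {n} {R : Rel (Fin n) 0ℓ} {xs u w v} →
              w ∈ₗ xs → Via R xs u w → Via R xs w v → Via R xs u v
  via-trans (here refl) (inj₁ p)       (inj₁ q)       = inj₂ (p , q)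
  via-trans (here refl) (inj₁ p)       (inj₂ (_ , q)) = inj₂ (p , q)
  via-trans (here refl) (inj₂ (p , _)) (inj₁ q)       = inj₂ (p , q)
  via-trans (here refl) (inj₂ (p , _)) (inj₂ (_ , q)) = inj₂ (p , q)
  via-trans (there w∈)  (inj₁ p)       (inj₁ q)       = inj₁ (via-trans w∈ p q)
  via-trans (there w∈)  (inj₁ p)       (inj₂ (q , r)) = inj₂ (via-trans w∈ p q , r)
  via-trans (there w∈)  (inj₂ (p , q)) (inj₁ r)       = inj₂ (p , via-trans w∈ q r)
  via-trans (there w∈)  (inj₂ (p , _)) (inj₂ (_ , r)) = inj₂ (p , r)

  star⇒via : ∀ {n} {R : Rel (Fin n) 0ℓ} {u v} → Star R u v → Via R (allFin n) u v
  star⇒via {n} ε        = base⇒via (allFin n) (inj₁ refl)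
  star⇒via {n} (r ◅ rs) =
    via-trans (∈-allFin _) (base⇒via (allFin n) (inj₂ r)) (star⇒via rs)

star? : ∀ {n} {R : Rel (Fin n) 0ℓ} → Decidable R → Decidable (Star R)
star? {n} R? u v = map′ (via⇒star (allFin n)) star⇒via (via? R? (allFin n) u v)

disconnects? : ∀ {n} (G : Graph n) (S : Subset n) → Dec (Disconnects G S)
disconnects? G S = any? λ u → any? λ v →
  ¬? (u ∈? S) ×-dec ¬? (v ∈? S) ×-dec ¬? (star? outside? u v)
  where
  outside? : Decidable (AdjOutside G S)
  outside? u v = ¬? (u ∈? S) ×-dec ¬? (v ∈? S) ×-dec adj? G u v

nonadjacent⇒disconnects : ∀ {n} (G : Graph n) {u v} → u ≢ v → ¬ Adj G u v →
                          Disconnects G (∁ (⁅ u ⁆ ∪ ⁅ v ⁆))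
nonadjacent⇒disconnects G {u} {v} u≢v ¬uv =
  u , v , x∈p⇒x∉∁p (x∈p∪q⁺ (inj₁ (x∈⁅x⁆ u))) , x∈p⇒x∉∁p (x∈p∪q⁺ (inj₂ (x∈⁅x⁆ v))) , separated
  where
  separated : ¬ Star (AdjOutside G (∁ (⁅ u ⁆ ∪ ⁅ v ⁆))) u v
  separated ε = u≢v refl
  separated ((_ , w∉ , uw) ◅ _) with x∈p∪q⁻ ⁅ u ⁆ ⁅ v ⁆ (x∉∁p⇒x∈p w∉)
  ... | inj₁ w∈u = adj-irrefl G (sym (x∈⁅y⁆⇒x≡y u w∈u)) uw
  ... | inj₂ w∈v with x∈⁅y⁆⇒x≡y v w∈v
  ...   | refl = ¬uv uw

smallest-disconnecting : ∀ {n} (G : Graph n) S → Disconnects G S →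
  ∃ λ T → Disconnects G T × (∀ U → Disconnects G U → ∣ T ∣ ≤ ∣ U ∣)
smallest-disconnecting {n} G S dS = <-rec Goal step ∣ S ∣ S refl dS
  where
  Goal : ℕ → Set
  Goal k = ∀ S → ∣ S ∣ ≡ k → Disconnects G S →
    ∃ λ T → Disconnects G T × (∀ U → Disconnects G U → ∣ T ∣ ≤ ∣ U ∣)

  step : ∀ k → (∀ {j} → j < k → Goal j) → Goal k
  step _ rec S refl dS with anySubset? (λ U → (∣ U ∣ <? ∣ S ∣) ×-dec disconnects? G U)
  ... | yes (U , U<S , dU) = rec U<S U refl dU
  ... | no  none           = S , dS , λ U dU → ≮⇒≥ λ U<S → none (U , U<S , dU)

connectivity : ∀ {n} (G : Graph n) → ∃ (IsConnectivity G)
connectivity {n} G with any? (λ u → any? (λ v → ¬? (u ≟ v) ×-dec ¬? (adj? G u v)))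
... | no none = n ∸ 1 , complete λ u v u≢v →
  decidable-stable (adj? G u v) λ ¬uv → none (u , v , u≢v , ¬uv)
... | yes (u , v , u≢v , ¬uv)
  with smallest-disconnecting G _ (nonadjacent⇒disconnects G u≢v ¬uv)
...   | T , dT , least =
  ∣ T ∣ , incomplete (λ K → ¬uv (K u v u≢v)) (T , dT , refl) least

κ : ∀ {n} → Graph n → ℕ
κ G = proj₁ (connectivity G)

κ-isConnectivity : ∀ {n} (G : Graph n) → IsConnectivity G (κ G)
κ-isConnectivity G = proj₂ (connectivity G)

minimum : ∀ {n} .{{_ : NonZero n}} → (Fin n → ℕ) → ℕ
minimum {suc n} f = foldr₁ _⊓_ (tabulate f)

module _ {n m : ℕ} {ℓ : Level} {I : Set ℓ} where

  ProductAdj : Graph n → (Fin n → I) → (I → Graph m) → Rel (Fin n × Fin m) 0ℓ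
  ProductAdj G h Γ (a , x) (b , y) = Adj G a b ⊎ (a ≡ b × Adj (Γ (h a)) x y)

  -- The vertex (a , x) is encoded as  combine a x : Fin (n * m),  which remQuot
  -- decodes.  The family Γ is indexed by I, and h a is an index of a member.
  infix 8 _∘[_]_
  _∘[_]_ : Graph n → (Fin n → I) → (I → Graph m) → Graph (n * m)
  G ∘[ h ] Γ = record
    { Adj        = λ i j → ProductAdj G h Γ (remQuot m i) (remQuot m j)
    ; adj?       = λ i j → dec (remQuot m i) (remQuot m j)
    ; adj-sym    = λ {i} {j} → symm (remQuot m i) (remQuot m j)
    ; adj-irrefl = λ { {i} refl → irr (remQuot m i) }
    }
    where
    dec : Decidable (ProductAdj G h Γ)
    dec (a , x) (b , y) = adj? G a b ⊎-dec (a ≟ b ×-dec adj? (Γ (h a)) x y)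

    symm : ∀ p q → ProductAdj G h Γ p q → ProductAdj G h Γ q p
    symm _       _ (inj₁ ab)          = inj₁ (adj-sym G ab)
    symm (a , _) _ (inj₂ (refl , xy)) = inj₂ (refl , adj-sym (Γ (h a)) xy)

    irr : ∀ p → ¬ ProductAdj G h Γ p p
    irr _       (inj₁ aa)       = adj-irrefl G refl aa
    irr (a , _) (inj₂ (_ , xx)) = adj-irrefl (Γ (h a)) refl xx

-- A vertex set S of G ∘ Γ that separates (a , x) from (b , y) is compared with
-- the set T of vertices of G whose whole fibre lies in S.  Every edge of G - T
-- lifts to an edge between vertices outside S, chosen freely in the fibres, so
-- a nonempty walk of G - T from a to b would join (a , x) to (b , y).  Hence
-- either T disconnects G, or a = b and T consists of all the other vertices.  In
-- the first case S has at least κ(G) m elements, and so it has in the second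
-- case when G is not complete, since then κ(G) ≤ n - 1.  When G is complete
-- only the second case occurs, and S must moreover disconnect h(a) inside the
-- fibre of a.  The bounds are attained by T × V for a smallest T disconnecting G,
-- and by all fibres but one together with a smallest set disconnecting that one;
-- if G and all h(v) are complete then so is the product, of order n m.
module Submission where

open import Defs
open import Data.Empty using (⊥)
open import Data.Fin using (Fin; zero; suc; combine; quotient; remainder)
open import Data.Fin.Properties
  using (_≟_; all?; ¬∀⟶∃¬; remQuot-combine; combine-surjective)
open import Data.Fin.Subset using (Subset; inside; outside; _∈_; _∉_; _⊆_; _⊂_; ∣_∣; ∁; ⁅_⁆; _∪_; ⊤)
open import Data.Fin.Subset.Properties
  using (_∈?_; ∈⊤; ∣⊤∣≡n; ∣⊥∣≡0; ∣∁p∣≡n∸∣p∣; ∣⁅x⁆∣≡1; x∈∁p⇒x∉p; x∉⁅y⁆⇒x≢y; x∈⁅x⁆; x∈⁅y⁆⇒x≡y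
        ; x∈p∪q⁻; p⊆p∪q; q⊆p∪q; p⊆q⇒∣p∣≤∣q∣; p⊂q⇒∣p∣<∣q∣)
open import Data.Nat using (ℕ; zero; suc; NonZero; _+_; _*_; _∸_; _≤_; _<_)
open import Data.Nat.Properties
  using (≤-refl; ≤-reflexive; ≤-trans; ≤-antisym; <⇒≤; <⇒≤pred; <⇒≱; n≤0⇒n≡0
        ; ≤-<-trans; +-comm; +-assoc; +-monoʳ-≤; *-zeroʳ; *-monoˡ-≤; m⊓n≤m; m⊓n≤n; ⊓-sel
        ; module ≤-Reasoning)
open import Data.Product using (∃; _×_; _,_; proj₁; proj₂)
open import Data.Sum using (_⊎_; inj₁; inj₂; [_,_]′)
open import Data.Vec using (Vec; []; _∷_; _++_; concat; lookup; map; replicate; tabulate; _[_]≔_)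
open import Data.Vec.Properties
  using (lookup-concat; lookup-map; lookup-replicate; lookup∘tabulate; lookup∘update
        ; lookup∘update′; []=⇒lookup; lookup⇒[]=)
open import Function using (_∘_)
open import Level using (Level)
open import Relation.Binary.Construct.Closure.ReflexiveTransitive
  using (Star; ε; _◅_; gmap; kleisliStar)
open import Relation.Binary.PropositionalEquality
  using (_≡_; _≢_; refl; sym; trans; cong; cong₂; subst; subst₂; module ≡-Reasoning)
open import Relation.Nullary using (¬_; Dec; yes; no; does; contradiction)
open import Relation.Nullary.Decidable using (decidable-stable; dec-true; dec-false)
open import Relation.Unary using (Pred; Decidable)

-- Subsets given by decidable predicates

⟦_⟧ : ∀ {n p} {P : Pred (Fin n) p} → Decidable P → Subset n
⟦ P? ⟧ = tabulate (does ∘ P?)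

∈⟦⟧⁺ : ∀ {n p} {P : Pred (Fin n) p} (P? : Decidable P) {x} → P x → x ∈ ⟦ P? ⟧
∈⟦⟧⁺ P? {x} px =
  lookup⇒[]= x _ (trans (lookup∘tabulate (does ∘ P?) x) (dec-true (P? x) px))

∈⟦⟧⁻ : ∀ {n p} {P : Pred (Fin n) p} (P? : Decidable P) {x} → x ∈ ⟦ P? ⟧ → P x
∈⟦⟧⁻ P? {x} x∈ = decidable-stable (P? x) λ ¬px →
  contradiction
    (trans (sym (dec-false (P? x) ¬px))
           (trans (sym (lookup∘tabulate (does ∘ P?) x)) ([]=⇒lookup x∈)))
    λ ()

∣∁⁅x⁆∣≡n∸1 : ∀ {n} (x : Fin n) → ∣ ∁ ⁅ x ⁆ ∣ ≡ n ∸ 1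
∣∁⁅x⁆∣≡n∸1 {n} x = trans (∣∁p∣≡n∸∣p∣ ⁅ x ⁆) (cong (n ∸_) (∣⁅x⁆∣≡1 x))

-- Vertex sets of the product, one block per fibre

∣p++q∣≡∣p∣+∣q∣ : ∀ {m n} (p : Subset m) (q : Subset n) → ∣ p ++ q ∣ ≡ ∣ p ∣ + ∣ q ∣
∣p++q∣≡∣p∣+∣q∣ []            q = refl
∣p++q∣≡∣p∣+∣q∣ (inside  ∷ p) q = cong suc (∣p++q∣≡∣p∣+∣q∣ p q)
∣p++q∣≡∣p∣+∣q∣ (outside ∷ p) q = ∣p++q∣≡∣p∣+∣q∣ p q

∈-concat⁺ : ∀ {n m} (ps : Vec (Subset m) n) {a x} → x ∈ lookup ps a → combine a x ∈ concat ps
∈-concat⁺ ps {a} {x} x∈ = lookup⇒[]= _ _ (trans (lookup-concat ps a x) ([]=⇒lookup x∈))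

∈-concat⁻ : ∀ {n m} (ps : Vec (Subset m) n) {a x} → combine a x ∈ concat ps → x ∈ lookup ps a
∈-concat⁻ ps {a} {x} ax∈ = lookup⇒[]= _ _ (trans (sym (lookup-concat ps a x)) ([]=⇒lookup ax∈))

⊆-by-combine : ∀ {n m} {p q : Subset (n * m)} →
               (∀ a x → combine a x ∈ p → combine a x ∈ q) → p ⊆ q
⊆-by-combine {n} {m} p⇒q {i} i∈p with combine-surjective {n} {m} i
... | a , x , refl = p⇒q a x i∈p

quotient-combine : ∀ {n m} (a : Fin n) (x : Fin m) → quotient {n} m (combine a x) ≡ a
quotient-combine a x = cong proj₁ (remQuot-combine a x)

remainder-combine : ∀ {n m} (a : Fin n) (x : Fin m) → remainder {n} m (combine a x) ≡ x
remainder-combine a x = cong proj₂ (remQuot-combine a x)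

-- This is T × V: position `x` of block `a` is the vertex `combine a x`, so sizes can be counted
-- block by block.
cylinder : ∀ {n} m → Subset n → Subset (n * m)
cylinder m T = concat (map (replicate m) T)

∣cylinder∣ : ∀ {n} m (T : Subset n) → ∣ cylinder m T ∣ ≡ ∣ T ∣ * m
∣cylinder∣ m []            = refl
∣cylinder∣ m (inside  ∷ T) =
  trans (∣p++q∣≡∣p∣+∣q∣ (replicate m inside) _) (cong₂ _+_ (∣⊤∣≡n m) (∣cylinder∣ m T))
∣cylinder∣ m (outside ∷ T) =
  trans (∣p++q∣≡∣p∣+∣q∣ (replicate m outside) _) (cong₂ _+_ (∣⊥∣≡0 m) (∣cylinder∣ m T))

lookup-cylinder : ∀ {n m} (T : Subset n) a (x : Fin m) →
                  lookup (cylinder m T) (combine a x) ≡ lookup T a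
lookup-cylinder {m = m} T a x = begin
  lookup (cylinder m T) (combine a x)     ≡⟨ lookup-concat (map (replicate m) T) a x ⟩
  lookup (lookup (map (replicate m) T) a) x ≡⟨ cong (λ p → lookup p x) (lookup-map a _ T) ⟩
  lookup (replicate m (lookup T a)) x     ≡⟨ lookup-replicate x _ ⟩
  lookup T a                              ∎
  where open ≡-Reasoning

∈-cylinder⁺ : ∀ {n m} (T : Subset n) {a} {x : Fin m} → a ∈ T → combine a x ∈ cylinder m T
∈-cylinder⁺ T {a} {x} a∈T =
  lookup⇒[]= _ _ (trans (lookup-cylinder T a x) ([]=⇒lookup a∈T))

∈-cylinder⁻ : ∀ {n m} (T : Subset n) {a} {x : Fin m} → combine a x ∈ cylinder m T → a ∈ T
∈-cylinder⁻ T {a} {x} ax∈ =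
  lookup⇒[]= _ _ (trans (sym (lookup-cylinder T a x)) ([]=⇒lookup ax∈))

-- The extremal set for complete `G`: after its deletion only vertices over `a` remain, those
-- outside `U`.
allBut : ∀ {n m} → Fin n → Subset m → Subset (n * m)
allBut {n} a U = concat (replicate n ⊤ [ a ]≔ U)

∣allBut∣ : ∀ {n m} (a : Fin n) (U : Subset m) → ∣ allBut a U ∣ ≡ (n ∸ 1) * m + ∣ U ∣
∣allBut∣ {suc n} {m} zero U = begin
  ∣ U ++ concat (replicate n ⊤) ∣  ≡⟨ ∣p++q∣≡∣p∣+∣q∣ U _ ⟩
  ∣ U ∣ + ∣ concat (replicate n (⊤ {m})) ∣ ≡⟨ cong (∣ U ∣ +_) (full n) ⟩
  ∣ U ∣ + n * m                    ≡⟨ +-comm ∣ U ∣ _ ⟩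
  n * m + ∣ U ∣                    ∎
  where
  open ≡-Reasoning
  full : ∀ k → ∣ concat (replicate k (⊤ {m})) ∣ ≡ k * m
  full zero    = refl
  full (suc k) = trans (∣p++q∣≡∣p∣+∣q∣ (⊤ {m}) _) (cong₂ _+_ (∣⊤∣≡n m) (full k))
∣allBut∣ {suc (suc n)} {m} (suc a) U = begin
  ∣ ⊤ {m} ++ allBut a U ∣    ≡⟨ ∣p++q∣≡∣p∣+∣q∣ (⊤ {m}) _ ⟩
  ∣ ⊤ {m} ∣ + ∣ allBut a U ∣ ≡⟨ cong₂ _+_ (∣⊤∣≡n m) (∣allBut∣ a U) ⟩
  m + (n * m + ∣ U ∣)        ≡⟨ +-assoc m _ _ ⟨
  m + n * m + ∣ U ∣          ∎
  where open ≡-Reasoning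

∈-allBut-same⁺ : ∀ {n m} (a : Fin n) (U : Subset m) {x} → x ∈ U → combine a x ∈ allBut a U
∈-allBut-same⁺ {n} a U {x} x∈U =
  ∈-concat⁺ (replicate n ⊤ [ a ]≔ U) (subst (x ∈_) (sym (lookup∘update a (replicate n ⊤) U)) x∈U)

∈-allBut-same⁻ : ∀ {n m} (a : Fin n) (U : Subset m) {x} → combine a x ∈ allBut a U → x ∈ U
∈-allBut-same⁻ {n} a U {x} ax∈ =
  subst (x ∈_) (lookup∘update a (replicate n ⊤) U) (∈-concat⁻ (replicate n ⊤ [ a ]≔ U) ax∈)

∈-allBut-other : ∀ {n m} (a : Fin n) (U : Subset m) {c x} → c ≢ a → combine c x ∈ allBut a U
∈-allBut-other {n} a U {c} {x} c≢a =
  ∈-concat⁺ (replicate n ⊤ [ a ]≔ U)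
    (subst (x ∈_) (sym (trans (lookup∘update′ c≢a (replicate n ⊤) U) (lookup-replicate c ⊤))) ∈⊤)

-- Minimum over a finite nonempty index set

minimum-≤ : ∀ {n} .{{_ : NonZero n}} (f : Fin n → ℕ) v → minimum f ≤ f v
minimum-≤ {suc zero}    f zero    = ≤-refl
minimum-≤ {suc (suc n)} f zero    = m⊓n≤m (f zero) _
minimum-≤ {suc (suc n)} f (suc v) = ≤-trans (m⊓n≤n (f zero) _) (minimum-≤ (f ∘ suc) v)

minimum-attained : ∀ {n} .{{_ : NonZero n}} (f : Fin n → ℕ) → ∃ λ v → minimum f ≡ f v
minimum-attained {suc zero}    f = zero , refl
minimum-attained {suc (suc n)} f
  with ⊓-sel (f zero) (minimum (f ∘ suc)) | minimum-attained (f ∘ suc)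
... | inj₁ eq | _       = zero  , eq
... | inj₂ eq | v , eq′ = suc v , trans eq eq′

-- Connectivity

module _ {n} (G : Graph n) where

  disconnects⇒¬complete : ∀ {S} → Disconnects G S → ¬ Complete G
  disconnects⇒¬complete (u , v , u∉S , v∉S , ¬uv) K with u ≟ v
  ... | yes refl = ¬uv ε
  ... | no  u≢v  = ¬uv ((u∉S , v∉S , K u v u≢v) ◅ ε)

  -- Separated vertices are distinct, since the empty walk joins a vertex to itself. So `u` and `v`
  -- witness the two strict inclusions from `S` to `S ∪ ⁅ u ⁆` to `⊤`.
  disconnects⇒1+∣S∣<n : ∀ {S} → Disconnects G S → suc ∣ S ∣ < n
  disconnects⇒1+∣S∣<n {S} (u , v , u∉S , v∉S , ¬uv) =
    ≤-<-trans (p⊂q⇒∣p∣<∣q∣ S⊂S∪u) (subst (∣ S ∪ ⁅ u ⁆ ∣ <_) (∣⊤∣≡n n) (p⊂q⇒∣p∣<∣q∣ S∪u⊂⊤))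
    where
    S⊂S∪u : S ⊂ S ∪ ⁅ u ⁆
    S⊂S∪u = p⊆p∪q ⁅ u ⁆ , u , q⊆p∪q S ⁅ u ⁆ (x∈⁅x⁆ u) , u∉S
    v∉S∪u : v ∉ S ∪ ⁅ u ⁆
    v∉S∪u v∈ with x∈p∪q⁻ S ⁅ u ⁆ v∈
    ... | inj₁ v∈S = v∉S v∈S
    ... | inj₂ v∈u with x∈⁅y⁆⇒x≡y u v∈u
    ...   | refl = ¬uv ε
    S∪u⊂⊤ : S ∪ ⁅ u ⁆ ⊂ ⊤
    S∪u⊂⊤ = (λ _ → ∈⊤) , v , ∈⊤ , v∉S∪u

  isConnectivity-unique : ∀ {j k} → IsConnectivity G j → IsConnectivity G k → j ≡ k
  isConnectivity-unique (complete _)        (complete _)        = refl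
  isConnectivity-unique (complete K)        (incomplete ¬K _ _) = contradiction K ¬K
  isConnectivity-unique (incomplete ¬K _ _) (complete K)        = contradiction K ¬K
  isConnectivity-unique (incomplete _ (S , dS , refl) S-least)
                        (incomplete _ (T , dT , refl) T-least) =
    ≤-antisym (S-least T dT) (T-least S dS)

  -- Through this a value of `κ` is found by exhibiting a certificate, without unfolding the search
  -- that defines it.
  κ-unique : ∀ {k} → IsConnectivity G k → κ G ≡ k
  κ-unique = isConnectivity-unique (κ-isConnectivity G)

  -- The constructor of the certificate behind `κ G` settles the question.
  complete? : Dec (Complete G)
  complete? with κ G | κ-isConnectivity G
  ... | _ | complete K        = yes K
  ... | _ | incomplete ¬K _ _ = no ¬K

  κ-attained : ¬ Complete G → ∃ λ S → Disconnects G S × ∣ S ∣ ≡ κ G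
  κ-attained ¬K with κ G | κ-isConnectivity G
  ... | _ | complete K         = contradiction K ¬K
  ... | _ | incomplete _ ex _  = ex

  κ≤∣disconnecting∣ : ∀ {S} → Disconnects G S → κ G ≤ ∣ S ∣
  κ≤∣disconnecting∣ dS with κ G | κ-isConnectivity G
  ... | _ | complete K           = contradiction K (disconnects⇒¬complete dS)
  ... | _ | incomplete _ _ least = least _ dS

  -- By this strict bound the number `κ` alone tells complete graphs from incomplete ones of the
  -- same order.
  incomplete⇒1+κ<n : ¬ Complete G → suc (κ G) < n
  incomplete⇒1+κ<n ¬K with κ-attained ¬K
  ... | S , dS , eq = subst (λ k → suc k < n) eq (disconnects⇒1+∣S∣<n dS)

  κ≤n∸1 : κ G ≤ n ∸ 1
  κ≤n∸1 with complete?
  ... | yes K = ≤-reflexive (κ-unique (complete K))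
  ... | no ¬K = <⇒≤pred (<⇒≤ (incomplete⇒1+κ<n ¬K))

-- The product

module _ {n m} (G : Graph n) {ℓ} {I : Set ℓ} (Γ : I → Graph m) (h : Fin n → I) where

  private
    P : Graph (n * m)
    P = G ∘[ h ] Γ

  adj-combine⁺ : ∀ {a x b y} → ProductAdj G h Γ (a , x) (b , y) → Adj P (combine a x) (combine b y)
  adj-combine⁺ {a} {x} {b} {y} =
    subst₂ (ProductAdj G h Γ) (sym (remQuot-combine a x)) (sym (remQuot-combine b y))

  adj-combine⁻ : ∀ {a x b y} → Adj P (combine a x) (combine b y) → ProductAdj G h Γ (a , x) (b , y)
  adj-combine⁻ {a} {x} {b} {y} =
    subst₂ (ProductAdj G h Γ) (remQuot-combine a x) (remQuot-combine b y)

  -- The first coordinate turns a walk avoiding the cylinder into a walk of `G` avoiding `T`. An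
  -- edge inside a fibre becomes the empty walk, so edges are sent to walks and not to edges. The
  -- `Fin m` argument supplies vertices over `u` and `v`.
  cylinder-disconnects : ∀ {T} → Fin m → Disconnects G T → Disconnects P (cylinder m T)
  cylinder-disconnects {T} x (u , v , u∉T , v∉T , ¬uv) =
    combine u x , combine v x , u∉T ∘ ∈-cylinder⁻ T , v∉T ∘ ∈-cylinder⁻ T , λ walk →
      ¬uv (subst₂ (Star (AdjOutside G T)) (quotient-combine u x) (quotient-combine v x)
             (kleisliStar (quotient m) project walk))
    where
    project-combine : ∀ {a y b z} → combine a y ∉ cylinder m T → combine b z ∉ cylinder m T →
                      ProductAdj G h Γ (a , y) (b , z) → Star (AdjOutside G T) a b
    project-combine ay∉ bz∉ (inj₁ ab)         = (ay∉ ∘ ∈-cylinder⁺ T , bz∉ ∘ ∈-cylinder⁺ T , ab) ◅ ε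
    project-combine _   _   (inj₂ (refl , _)) = ε

    project : ∀ {i j} → AdjOutside P (cylinder m T) i j →
              Star (AdjOutside G T) (quotient m i) (quotient m j)
    project {i} {j} (i∉ , j∉ , ij) with combine-surjective {n} {m} i | combine-surjective {n} {m} j
    ... | a , y , refl | b , z , refl =
      subst₂ (Star (AdjOutside G T)) (sym (quotient-combine a y)) (sym (quotient-combine b z))
        (project-combine i∉ j∉ (adj-combine⁻ ij))

  -- Only the fibre of `v` survives the deletion, and there an edge coming from `G` would be a loop
  -- at `v`. So the second coordinate sends edges to edges of `Γ (h v)`.
  allBut-disconnects : ∀ {U} v → Disconnects (Γ (h v)) U → Disconnects P (allBut v U)
  allBut-disconnects {U} v (x , y , x∉U , y∉U , ¬xy) =
    combine v x , combine v y , x∉U ∘ ∈-allBut-same⁻ v U , y∉U ∘ ∈-allBut-same⁻ v U , λ walk →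
      ¬xy (subst₂ (Star (AdjOutside (Γ (h v)) U)) (remainder-combine v x) (remainder-combine v y)
             (gmap (remainder {n} m) project walk))
    where
    in-fibre : ∀ {a z} → combine a z ∉ allBut v U → a ≡ v
    in-fibre {a} az∉ = decidable-stable (a ≟ v) (az∉ ∘ ∈-allBut-other v U)

    project : ∀ {i j} → AdjOutside P (allBut v U) i j →
              AdjOutside (Γ (h v)) U (remainder {n} m i) (remainder {n} m j)
    project {i} {j} (i∉ , j∉ , ij) with combine-surjective {n} {m} i | combine-surjective {n} {m} j
    ... | a , z , refl | b , w , refl with in-fibre i∉ | in-fibre j∉ | adj-combine⁻ ij
    ... | refl | refl | inj₁ vv       = contradiction vv (adj-irrefl G refl)
    ... | refl | refl | inj₂ (_ , zw) =
      subst₂ (AdjOutside (Γ (h v)) U) (sym (remainder-combine v z)) (sym (remainder-combine v w))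
        (i∉ ∘ ∈-allBut-same⁺ v U , j∉ ∘ ∈-allBut-same⁺ v U , zw)

  -- Full fibres and the lifting of walks

  module _ (S : Subset (n * m)) where

    fibre? : ∀ (a : Fin n) → Decidable (λ x → combine a x ∈ S)
    fibre? a x = combine a x ∈? S

    fibre : Fin n → Subset m
    fibre a = ⟦ fibre? a ⟧

    full? : Decidable (λ (a : Fin n) → ∀ x → combine a x ∈ S)
    full? a = all? (fibre? a)

    -- The set T of the lower bound: over each vertex outside it some vertex outside `S` is
    -- available for lifting.
    fullFibres : Subset n
    fullFibres = ⟦ full? ⟧

    ∉fullFibres⁺ : ∀ {a x} → combine a x ∉ S → a ∉ fullFibres
    ∉fullFibres⁺ {x = x} ax∉S a∈ = ax∉S (∈⟦⟧⁻ full? a∈ x)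

    ∉fullFibres⁻ : ∀ {a} → a ∉ fullFibres → ∃ λ x → combine a x ∉ S
    ∉fullFibres⁻ {a} a∉ = ¬∀⟶∃¬ m _ (fibre? a) (a∉ ∘ ∈⟦⟧⁺ full?)

    -- An edge of `G` joins whole fibres, so any surviving vertex over an intermediate vertex will
    -- do. The first edge is a separate argument because the empty walk need not lift: `x` and `y`
    -- may differ when `a` is `b`.
    lift-walk : ∀ {a b c x y} → combine a x ∉ S → combine b y ∉ S →
                AdjOutside G fullFibres a c → Star (AdjOutside G fullFibres) c b →
                Star (AdjOutside P S) (combine a x) (combine b y)
    lift-walk ax∉ by∉ (_ , _  , ab) ε = (ax∉ , by∉ , adj-combine⁺ (inj₁ ab)) ◅ ε
    lift-walk ax∉ by∉ (_ , c∉ , ac) (cd ◅ walk) with ∉fullFibres⁻ c∉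
    ... | z , cz∉ = (ax∉ , cz∉ , adj-combine⁺ (inj₁ ac)) ◅ lift-walk cz∉ by∉ cd walk

    -- Going to a surviving vertex over `c` and back gives the walk, whatever `Γ (h a)` is.
    lift-detour : ∀ {a c x y} → combine a x ∉ S → combine a y ∉ S → AdjOutside G fullFibres a c →
                  Star (AdjOutside P S) (combine a x) (combine a y)
    lift-detour ax∉ ay∉ ac@(a∉ , c∉ , e) = lift-walk ax∉ ay∉ ac ((c∉ , a∉ , adj-sym G e) ◅ ε)

    ∣fullFibres∣*m≤∣S∣ : ∣ fullFibres ∣ * m ≤ ∣ S ∣
    ∣fullFibres∣*m≤∣S∣ = subst (_≤ ∣ S ∣) (∣cylinder∣ m fullFibres)
      (p⊆q⇒∣p∣≤∣q∣ (⊆-by-combine {n} λ a x ax∈ → ∈⟦⟧⁻ full? (∈-cylinder⁻ fullFibres {x = x} ax∈) x))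

    disconnecting-fullFibres : Disconnects P S → Disconnects G fullFibres ⊎ n ∸ 1 ≤ ∣ fullFibres ∣
    disconnecting-fullFibres (i , j , i∉ , j∉ , ¬ij)
      with combine-surjective {n} {m} i | combine-surjective {n} {m} j | disconnects? G fullFibres
    ... | _            | _            | yes d = inj₁ d
    ... | a , x , refl | b , y , refl | no ¬d =
      inj₂ (subst (_≤ ∣ fullFibres ∣) (∣∁⁅x⁆∣≡n∸1 a) (p⊆q⇒∣p∣≤∣q∣ others-full))
      where
      -- A nonempty walk to `b` lifts. If it is empty then `a` is `b`, and the first edge of the
      -- walk to `c` gives a detour.
      no-walks : ∀ {c} → c ≢ a → Star (AdjOutside G fullFibres) a c →
                 Star (AdjOutside G fullFibres) a b → ⊥
      no-walks _   _        (s ◅ walk) = ¬ij (lift-walk i∉ j∉ s walk)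
      no-walks c≢a ε        ε          = c≢a refl
      no-walks _   (s ◅ _)  ε          = ¬ij (lift-detour i∉ j∉ s)

      others-full : ∁ ⁅ a ⁆ ⊆ fullFibres
      -- `¬d` yields the walks to `c` and to `b` only under double negation, which suffices because
      -- the goal is now `⊥`.
      others-full {c} c∈ = decidable-stable (c ∈? fullFibres) λ c∉ →
        ¬d (a , c , ∉fullFibres⁺ i∉ , c∉ , λ a⇝c →
          ¬d (a , b , ∉fullFibres⁺ i∉ , ∉fullFibres⁺ j∉ ,
            no-walks (x∉⁅y⁆⇒x≢y (x∈∁p⇒x∉p c∈)) a⇝c))

    κ*m≤∣disconnecting∣ : Disconnects P S → κ G * m ≤ ∣ S ∣
    κ*m≤∣disconnecting∣ d = ≤-trans (*-monoˡ-≤ m κ≤∣fullFibres∣) ∣fullFibres∣*m≤∣S∣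
      where
      κ≤∣fullFibres∣ : κ G ≤ ∣ fullFibres ∣
      κ≤∣fullFibres∣ = [ κ≤∣disconnecting∣ G , ≤-trans (κ≤n∸1 G) ]′ (disconnecting-fullFibres d)

    -- Vertices of distinct fibres are adjacent, so the separated pair lies in one fibre. A vertex
    -- outside `S` in another fibre would give a detour between the two, and a walk inside the fibre
    -- would already be a walk of the product.
    complete⇒single-fibre : Complete G → Disconnects P S →
      ∃ λ a → Disconnects (Γ (h a)) (fibre a) × allBut a (fibre a) ⊆ S
    complete⇒single-fibre K (i , j , i∉ , j∉ , ¬ij)
      with combine-surjective {n} {m} i | combine-surjective {n} {m} j
    ... | a , x , refl | b , y , refl with a ≟ b
    ... | no a≢b   = contradiction ((i∉ , j∉ , adj-combine⁺ (inj₁ (K a b a≢b))) ◅ ε) ¬ij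
    ... | yes refl =
      a , (x , y , i∉ ∘ ∈⟦⟧⁻ (fibre? a) , j∉ ∘ ∈⟦⟧⁻ (fibre? a) , ¬ij ∘ gmap (combine a) embed)
        , ⊆-by-combine {n} within
      where
      embed : ∀ {z w} → AdjOutside (Γ (h a)) (fibre a) z w →
              AdjOutside P S (combine a z) (combine a w)
      embed (z∉ , w∉ , zw) =
        z∉ ∘ ∈⟦⟧⁺ (fibre? a) , w∉ ∘ ∈⟦⟧⁺ (fibre? a) , adj-combine⁺ (inj₂ (refl , zw))

      within : ∀ c z → combine c z ∈ allBut a (fibre a) → combine c z ∈ S
      within c z cz∈ with c ≟ a
      ... | yes refl = ∈⟦⟧⁻ (fibre? a) (∈-allBut-same⁻ a (fibre a) cz∈)
      ... | no  c≢a  = decidable-stable (combine c z ∈? S) λ cz∉ →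
        ¬ij (lift-detour i∉ j∉ (∉fullFibres⁺ i∉ , ∉fullFibres⁺ cz∉ , K a c (c≢a ∘ sym)))

    complete⇒≤∣disconnecting∣ : Complete G → Disconnects P S →
      ∃ λ a → (n ∸ 1) * m + κ (Γ (h a)) ≤ ∣ S ∣
    complete⇒≤∣disconnecting∣ K d with complete⇒single-fibre K d
    ... | a , da , within = a , (begin
      (n ∸ 1) * m + κ (Γ (h a))    ≤⟨ +-monoʳ-≤ ((n ∸ 1) * m) (κ≤∣disconnecting∣ (Γ (h a)) da) ⟩
      (n ∸ 1) * m + ∣ fibre a ∣    ≡⟨ ∣allBut∣ a (fibre a) ⟨
      ∣ allBut a (fibre a) ∣       ≤⟨ p⊆q⇒∣p∣≤∣q∣ within ⟩
      ∣ S ∣                        ∎)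
      where open ≤-Reasoning

  complete-product : Complete G → (∀ v → Complete (Γ (h v))) → Complete P
  complete-product K Ks i j i≢j with combine-surjective {n} {m} i | combine-surjective {n} {m} j
  ... | a , x , refl | b , y , refl with a ≟ b
  ... | no  a≢b  = adj-combine⁺ (inj₁ (K a b a≢b))
  ... | yes refl = adj-combine⁺ (inj₂ (refl , Ks a x y λ { refl → i≢j refl }))

-- The two cases of the formula

n*m∸1 : ∀ n m .{{_ : NonZero n}} → n * m ∸ 1 ≡ (n ∸ 1) * m + (m ∸ 1)
-- For empty fibres truncation makes both sides zero.
n*m∸1 (suc n) zero    rewrite *-zeroʳ n = refl
n*m∸1 (suc n) (suc m) = +-comm m (n * suc m)

κ-product-complete : ∀ {n m} .{{_ : NonZero n}} (G : Graph n) {ℓ} {I : Set ℓ} (Γ : I → Graph m)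
  (h : Fin n → I) → Complete G →
  κ (G ∘[ h ] Γ) ≡ (n ∸ 1) * m + minimum (λ v → κ (Γ (h v)))
κ-product-complete {n} {m} G Γ h K with minimum-attained (λ v → κ (Γ (h v)))
-- It is enough to test a fibre where the minimum is attained: if its graph is complete then all
-- are, and if not, a smallest set disconnecting it gives the extremal set.
... | v₀ , min≡ with complete? (Γ (h v₀))
... | yes K₀ = begin
  κ (G ∘[ h ] Γ)
    ≡⟨ κ-unique _ (complete (complete-product G Γ h K all-complete)) ⟩
  n * m ∸ 1                                    ≡⟨ n*m∸1 n m ⟩
  (n ∸ 1) * m + (m ∸ 1)                        ≡⟨ cong ((n ∸ 1) * m +_) min≡m∸1 ⟨
  (n ∸ 1) * m + minimum (λ v → κ (Γ (h v)))    ∎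
  where
  open ≡-Reasoning
  min≡m∸1 : minimum (λ v → κ (Γ (h v))) ≡ m ∸ 1
  min≡m∸1 = trans min≡ (κ-unique (Γ (h v₀)) (complete K₀))

  all-complete : ∀ v → Complete (Γ (h v))
  -- The minimum is `m ∸ 1`, while an incomplete graph on `m` vertices has smaller connectivity.
  all-complete v = decidable-stable (complete? (Γ (h v))) λ ¬K →
    <⇒≱ (<⇒≤pred (incomplete⇒1+κ<n (Γ (h v)) ¬K))
        (≤-trans (≤-reflexive (sym min≡m∸1)) (minimum-≤ (λ v → κ (Γ (h v))) v))
... | no ¬K₀ with κ-attained (Γ (h v₀)) ¬K₀
... | U , dU , ∣U∣≡κ =
  κ-unique _ (incomplete (disconnects⇒¬complete (G ∘[ h ] Γ) d) (allBut v₀ U , d , size) least)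
  where
  d : Disconnects (G ∘[ h ] Γ) (allBut v₀ U)
  d = allBut-disconnects G Γ h v₀ dU

  size : ∣ allBut v₀ U ∣ ≡ (n ∸ 1) * m + minimum (λ v → κ (Γ (h v)))
  size = trans (∣allBut∣ v₀ U) (cong ((n ∸ 1) * m +_) (trans ∣U∣≡κ (sym min≡)))

  least : ∀ S → Disconnects (G ∘[ h ] Γ) S → (n ∸ 1) * m + minimum (λ v → κ (Γ (h v))) ≤ ∣ S ∣
  least S dS with complete⇒≤∣disconnecting∣ G Γ h S K dS
  ... | a , bound = ≤-trans (+-monoʳ-≤ ((n ∸ 1) * m) (minimum-≤ (λ v → κ (Γ (h v))) a)) bound

κ-product-incomplete : ∀ {n m} (G : Graph n) {ℓ} {I : Set ℓ} (Γ : I → Graph m)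
  (h : Fin n → I) → ¬ Complete G → κ (G ∘[ h ] Γ) ≡ κ G * m
-- With empty fibres the product has no vertices, so no cylinder can disconnect it. The general
-- bound by the order minus one, truncated, gives zero instead.
κ-product-incomplete {n} {zero} G Γ h _ = trans (n≤0⇒n≡0 κ≤0) (sym (*-zeroʳ (κ G)))
  where
  κ≤0 : κ (G ∘[ h ] Γ) ≤ 0
  κ≤0 = subst (λ k → κ (G ∘[ h ] Γ) ≤ k ∸ 1) (*-zeroʳ n) (κ≤n∸1 (G ∘[ h ] Γ))
κ-product-incomplete {n} {m@(suc _)} G Γ h ¬K with κ-attained G ¬K
... | T , dT , ∣T∣≡κ =
  κ-unique _ (incomplete (disconnects⇒¬complete (G ∘[ h ] Γ) d)
    (cylinder m T , d , trans (∣cylinder∣ m T) (cong (_* m) ∣T∣≡κ))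
    (κ*m≤∣disconnecting∣ G Γ h))
  where
  d : Disconnects (G ∘[ h ] Γ) (cylinder m T)
  -- Here `zero` is a vertex of the nonempty set V.
  d = cylinder-disconnects G Γ h zero dT

theorem2p8 : ∀ {n m : ℕ} .{{_ : NonZero n}} (G : Graph n) → Connected G →
    ∀ {ℓ : Level} {I : Set ℓ} (Γ : I → Graph m) (h : Fin n → I) →
    (Complete G → κ (G ∘[ h ] Γ) ≡ (n ∸ 1) * m + minimum (λ v → κ (Γ (h v))))
    × (¬ Complete G → κ (G ∘[ h ] Γ) ≡ κ G * m)
theorem2p8 G _ Γ h = κ-product-complete G Γ h , κ-product-incomplete G Γ h
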